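{- There is an algorithm which, given a set $S$ of $n$ intervals on the real line whose $2n$ endpoints are pairwise distinct and which is already sorted by right endpoint, computes in $O(n)$ time an optimal solution of the Maximum Bipartite Subgraph problem on $S$, i.e. a maximum-cardinality subset $S'\subseteq S$ such that the intersection graph of the intervals in $S'$ is bipartite.
   Context: The intersection graph of a set of intervals has one vertex per interval, and two vertices are adjacent if and only if the corresponding intervals intersect. The Maximum Bipartite Subgraph (MBS) problem on a set $S$ of geometric objects asks for a maximum-size subset $S'\subseteq S$ whose intersection graph is bipartite. Running times count elementary operations, including comparisons of real numbers, at unit cost. -}

module Defs where

open import Level using (Level; _⊔_)
open import Data.Bool using (Bool; if_then_else_)
open import Data.Fin using (Fin; toℕ)
import Data.Fin as Fin
open import Data.Fin.Subset using (Subset; _∈_; ∣_∣)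
open import Data.List using (List; head; drop)
open import Data.Maybe using (Maybe; just; nothing)
open import Data.Nat using (ℕ; suc; _+_; _*_; _∸_; _≤_; _≡ᵇ_; _≤ᵇ_)
open import Data.Product using (_×_; ∃; ∃-syntax; _,_; proj₁)
open import Data.Sum using (_⊎_; [_,_]′)
open import Data.Vec using (lookup)
open import Function using (_∘_)
open import Function.Definitions using (Injective)
open import Relation.Binary using (DecTotalOrder)
open import Relation.Binary.PropositionalEquality using (_≡_; _≢_; refl; ≢-sym)
open import Relation.Nullary using (¬_; does)

infix 4 _∈O_

_∈O_ : (ℕ → ℕ) → (ℕ → ℕ) → Set
f ∈O g = ∃[ C ] ∃[ n₀ ] (∀ n → n₀ ≤ n → f n ≤ C * g n)

record Graph (v e : Level) : Set (Level.suc (v ⊔ e)) where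
  field
    Vertex      : Set v
    Adjacent    : Vertex → Vertex → Set e
    symmetric   : ∀ {x y} → Adjacent x y → Adjacent y x
    irreflexive : ∀ {x} → ¬ Adjacent x x

Bipartite : ∀ {v e} → Graph v e → Set (v ⊔ e)
Bipartite G = ∃ λ (side : Vertex → Bool) → ∀ x y → Adjacent x y → side x ≢ side y
  where open Graph G

-- A random access machine with integer registers, real registers, an integer
-- memory and a real memory.  Registers are named by constants in the program;
-- memory cells are addressed through an integer register.  The only
-- operations on reals are copying and comparison.  There is no integer
-- multiplication, as charging it unit cost would be unreasonably generous.

data Instruction : Set where
  set    : (d k : ℕ) → Instruction
  add    : (d i j : ℕ) → Instruction
  sub    : (d i j : ℕ) → Instruction
  load   : (d i : ℕ) → Instruction
  store  : (i j : ℕ) → Instruction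
  copyᴿ  : (d i : ℕ) → Instruction
  loadᴿ  : (d i : ℕ) → Instruction
  storeᴿ : (i j : ℕ) → Instruction
  goto   : (p : ℕ) → Instruction
  if≤    : (i j p : ℕ) → Instruction
  if≤ᴿ   : (i j p : ℕ) → Instruction

Program : Set
Program = List Instruction

fetch : Program → ℕ → Maybe Instruction
fetch P p = head (drop p P)

infixl 6 _[_≔_]

_[_≔_] : ∀ {a} {A : Set a} → (ℕ → A) → ℕ → A → (ℕ → A)
(f [ d ≔ v ]) k = if k ≡ᵇ d then v else f k

-- The real line is represented by an arbitrary linear order in which
-- comparisons are decided: no other structure of ℝ is used.

module OverLine {a ℓ₁ ℓ₂} (Line : DecTotalOrder a ℓ₁ ℓ₂) where

  open DecTotalOrder Line using () renaming
    (Carrier to ℝ; _≈_ to _≈ᴿ_; _≤_ to _≤ᴿ_; _≤?_ to _≤ᴿ?_)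

  record State : Set a where
    constructor state
    field
      pc   : ℕ
      I    : ℕ → ℕ
      IMem : ℕ → ℕ
      R    : ℕ → ℝ
      RMem : ℕ → ℝ

  execute : Instruction → State → State
  execute (set d k)    (state p I M R X) = state (suc p) (I [ d ≔ k ]) M R X
  execute (add d i j)  (state p I M R X) = state (suc p) (I [ d ≔ I i + I j ]) M R X
  execute (sub d i j)  (state p I M R X) = state (suc p) (I [ d ≔ I i ∸ I j ]) M R X
  execute (load d i)   (state p I M R X) = state (suc p) (I [ d ≔ M (I i) ]) M R X
  execute (store i j)  (state p I M R X) = state (suc p) I (M [ I i ≔ I j ]) R X
  execute (copyᴿ d i)  (state p I M R X) = state (suc p) I M (R [ d ≔ R i ]) X
  execute (loadᴿ d i)  (state p I M R X) = state (suc p) I M (R [ d ≔ X (I i) ]) X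
  execute (storeᴿ i j) (state p I M R X) = state (suc p) I M R (X [ I i ≔ R j ])
  execute (goto q)     (state p I M R X) = state q I M R X
  execute (if≤ i j q)  (state p I M R X) =
    state (if I i ≤ᵇ I j then q else suc p) I M R X
  execute (if≤ᴿ i j q) (state p I M R X) =
    state (if does (R i ≤ᴿ? R j) then q else suc p) I M R X

  infix 4 _⊢_⇓[_]_

  -- P ⊢ s ⇓[ t ] s′ : started in s, the program P stops in s′ after
  -- executing exactly t instructions.  It stops when the program counter
  -- leaves the program.
  data _⊢_⇓[_]_ (P : Program) : State → ℕ → State → Set a where
    stop : ∀ {s} → fetch P (State.pc s) ≡ nothing → P ⊢ s ⇓[ 0 ] s
    step : ∀ {s ins t s′} → fetch P (State.pc s) ≡ just ins →
           P ⊢ execute ins s ⇓[ t ] s′ → P ⊢ s ⇓[ suc t ] s′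

  record Interval : Set (a ⊔ ℓ₂) where
    field
      left right : ℝ
      left≤right : left ≤ᴿ right

  open Interval public

  _∈ᴵ_ : ℝ → Interval → Set ℓ₂
  x ∈ᴵ J = left J ≤ᴿ x × x ≤ᴿ right J

  Intersect : Interval → Interval → Set (a ⊔ ℓ₂)
  Intersect J K = ∃[ x ] (x ∈ᴵ J × x ∈ᴵ K)

  intersectionGraph : ∀ {v} {V : Set v} → (V → Interval) → Graph v (v ⊔ a ⊔ ℓ₂)
  intersectionGraph {V = V} S = record
    { Vertex      = V
    ; Adjacent    = λ u w → u ≢ w × Intersect (S u) (S w)
    ; symmetric   = λ { (u≢w , x , x∈u , x∈w) → ≢-sym u≢w , x , x∈w , x∈u }
    ; irreflexive = λ { (u≢u , _) → u≢u refl }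
    }

  restrict : ∀ {n} → (Fin n → Interval) → (S′ : Subset n) → ∃ (_∈ S′) → Interval
  restrict S S′ = S ∘ proj₁

  DistinctEndpoints : ∀ {n} → (Fin n → Interval) → Set ℓ₁
  DistinctEndpoints {n} S = Injective _≡_ _≈ᴿ_ endpoint
    where
    endpoint : Fin n ⊎ Fin n → ℝ
    endpoint = [ left ∘ S , right ∘ S ]′

  SortedByRightEndpoint : ∀ {n} → (Fin n → Interval) → Set ℓ₂
  SortedByRightEndpoint S = ∀ i j → i Fin.≤ j → right (S i) ≤ᴿ right (S j)

  InducesBipartite : ∀ {n} → (Fin n → Interval) → Subset n → Set (a ⊔ ℓ₂)
  InducesBipartite S S′ = Bipartite (intersectionGraph (restrict S S′))

  IsMaximumBipartiteSubgraph : ∀ {n} → (Fin n → Interval) → Subset n → Set (a ⊔ ℓ₂)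
  IsMaximumBipartiteSubgraph S S′ =
    InducesBipartite S S′ × (∀ S″ → InducesBipartite S S″ → ∣ S″ ∣ ≤ ∣ S′ ∣)

  -- Everything not mentioned here is arbitrary, so a program may not rely
  -- on the initial contents of the remaining registers and cells.
  record Encodes {n} (S : Fin n → Interval) (s : State) : Set a where
    open State s
    field
      start  : pc ≡ 0
      size   : I 0 ≡ n
      lefts  : ∀ i → RMem (2 * toℕ i) ≡ left (S i)
      rights : ∀ i → RMem (suc (2 * toℕ i)) ≡ right (S i)

  -- The first n integer cells hold the characteristic vector.
  Outputs : ∀ {n} → State → Subset n → Set
  Outputs s S′ = ∀ i → State.IMem s (toℕ i) ≡ (if lookup S′ i then 1 else 0)

  SolvesMBSWithin : ∀ {n} → Program → ℕ → (Fin n → Interval) → Set (a ⊔ ℓ₂)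
  SolvesMBSWithin {n} P T S = ∀ s → Encodes S s →
    ∃[ t ] ∃[ s′ ] ∃[ S′ ]
      (P ⊢ s ⇓[ t ] s′) × t ≤ T × Outputs {n} s′ S′ × IsMaximumBipartiteSubgraph S S′

{-# OPTIONS --safe #-}
module Submission where

-- A set of intervals is 2-colourable with disjoint colour classes iff, scanning by
-- right endpoint, each chosen interval can be appended to one of two classes whose
-- last right endpoint lies to its left.  The program greedily appends each interval
-- to the most recently extended class if it fits there, else to the other class, and
-- rejects it if it fits in neither.  Any competing choice that has accepted δ fewer
-- intervals so far can never catch up: if δ = 0 the greedy classes end no later than
-- the competing ones, and if δ = 1 the same holds once one greedy class is emptied.

open import Defs
open import Level using (Level)
open import Data.Bool using (Bool; true; false; if_then_else_)
import Data.Bool.Properties as Bool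
open import Data.Fin using (Fin; zero; suc; toℕ)
import Data.Fin as Fin
import Data.Fin.Properties as Fin
open import Data.Fin.Subset using (Subset; _∈_; ∣_∣)
open import Data.List using ([]; _∷_)
open import Data.Maybe using (Maybe; just; nothing)
open import Data.Nat using (ℕ; zero; suc; _+_; _*_; _≤_; _<_; z≤n; s≤s; _≤?_; _≟_)
open import Data.Nat.Properties
open import Data.Product using (Σ-syntax; ∃; ∃-syntax; _×_; _,_; proj₁)
open import Data.Sum using (inj₁; inj₂)
open import Data.Unit.Polymorphic using (⊤; tt)
open import Data.Vec using ([]; _∷_; here; there; lookup)
open import Data.Vec.Properties.WithK using ([]=-irrelevant)
open import Function using (_∘_; id)
open import Relation.Binary using (DecTotalOrder; tri<; tri≈; tri>)
open import Relation.Binary.PropositionalEquality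
  using (_≡_; _≢_; refl; sym; trans; cong; cong₂; subst; ≢-sym)
open import Relation.Nullary using (¬_; yes; no; contradiction)
open import Relation.Nullary.Decidable using (dec-true; dec-false)

≔-same : ∀ {a} {A : Set a} (f : ℕ → A) {d k v} → k ≡ d → (f [ d ≔ v ]) k ≡ v
-- `does (k ≟ d)` computes to `k ≡ᵇ d`, the test inside the update, so deciding the equality
-- evaluates the conditional.
≔-same f {d} {k} {v} k≡d =
  cong (λ b → if b then v else f k) (dec-true (k ≟ d) k≡d)

≔-other : ∀ {a} {A : Set a} (f : ℕ → A) {d k v} → k ≢ d → (f [ d ≔ v ]) k ≡ f k
≔-other f {d} {k} {v} k≢d =
  cong (λ b → if b then v else f k) (dec-false (k ≟ d) k≢d)

≢-pair-exhaustive : ∀ {s t v : Bool} → s ≢ t → v ≢ s → v ≡ t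
≢-pair-exhaustive s≢t v≢s = trans (Bool.¬-not v≢s) (sym (Bool.¬-not (≢-sym s≢t)))

-- The greedy program

-- Integer registers: 0 holds n, 1 the current index, 2 the address of the next
-- endpoint, 3 and 4 whether the most recently extended and the other class are
-- nonempty, 5 and 6 the constants 1 and 0.  Real registers: 0 and 1 hold the last
-- right endpoints of the two classes, 2 and 3 the endpoints of the current interval.
greedyProgram : Program
greedyProgram =
    set 1 0
  ∷ set 2 0
  ∷ set 3 0
  ∷ set 4 0
  ∷ set 5 1
  ∷ set 6 0
  ∷ if≤ 0 1 24    -- 6: next interval
  ∷ store 1 6
  ∷ loadᴿ 2 2
  ∷ add 2 2 5
  ∷ loadᴿ 3 2
  ∷ add 2 2 5
  ∷ if≤ 3 6 14
  ∷ if≤ᴿ 2 0 19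
  ∷ store 1 5     -- 14: accept
  ∷ set 3 1
  ∷ copyᴿ 0 3
  ∷ add 1 1 5     -- 17: advance
  ∷ goto 6
  ∷ if≤ 4 6 21    -- 19: try the other class
  ∷ if≤ᴿ 2 1 17
  ∷ set 4 1       -- 21: exchange the classes
  ∷ copyᴿ 1 0
  ∷ goto 14
  ∷ []

module _ {a ℓ₁ ℓ₂} (Line : DecTotalOrder a ℓ₁ ℓ₂) where
  open OverLine Line
  open DecTotalOrder Line using () renaming
    (Carrier to ℝ; _≤_ to _≤ᴿ_; _≤?_ to _≤ᴿ?_; refl to ≤ᴿ-refl; trans to ≤ᴿ-trans; total to ≤ᴿ-total)

  -- Class ends and feasible selections

  -- The last right endpoint of a colour class, or nothing if the class is empty.
  End : Set a
  End = Maybe ℝ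

  Free : End → Interval → Set ℓ₂
  Free nothing  J = ⊤
  Free (just e) J = ¬ left J ≤ᴿ e

  infix 4 _≼_

  -- Plays the role of "ends no later than". Comparing ends by the intervals they admit makes
  -- `nothing` least without adjoining a point at minus infinity, and makes transitivity function
  -- composition.
  _≼_ : End → End → Set _
  c ≼ d = ∀ J → Free d J → Free c J

  ≤⇒≼ : ∀ {x y} → x ≤ᴿ y → just x ≼ just y
  ≤⇒≼ x≤y _ l≰y l≤x = l≰y (≤ᴿ-trans l≤x x≤y)

  -- A free `J` starts after the end of the class, and its right end is no earlier than its left
  -- end; so appending never moves an end backwards.
  Free⇒≼right : ∀ c J → Free c J → c ≼ just (right J)
  Free⇒≼right nothing  J free _ _ = tt
  Free⇒≼right (just e) J free with ≤ᴿ-total e (left J)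
  ... | inj₁ e≤l = ≤⇒≼ (≤ᴿ-trans e≤l (left≤right J))
  ... | inj₂ l≤e = contradiction l≤e free

  -- Two classes, the first of which is the one extended last.
  data Feasible (c d : End) : ∀ {m} → (Fin m → Interval) → Subset m → Set (a Level.⊔ ℓ₂) where
    []     : {S : Fin 0 → Interval} → Feasible c d S []
    first  : ∀ {m F} {S : Fin (suc m) → Interval} → Free c (S zero) →
             Feasible (just (right (S zero))) d (S ∘ suc) F → Feasible c d S (true ∷ F)
    second : ∀ {m F} {S : Fin (suc m) → Interval} → Free d (S zero) →
             Feasible (just (right (S zero))) c (S ∘ suc) F → Feasible c d S (true ∷ F)
    skip   : ∀ {m F} {S : Fin (suc m) → Interval} →
             Feasible c d (S ∘ suc) F → Feasible c d S (false ∷ F)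

  data Greedy (c d : End) : ∀ {m} → (Fin m → Interval) → Subset m → Set (a Level.⊔ ℓ₂) where
    []     : {S : Fin 0 → Interval} → Greedy c d S []
    first  : ∀ {m G} {S : Fin (suc m) → Interval} → Free c (S zero) →
             Greedy (just (right (S zero))) d (S ∘ suc) G → Greedy c d S (true ∷ G)
    second : ∀ {m G} {S : Fin (suc m) → Interval} → ¬ Free c (S zero) → Free d (S zero) →
             Greedy (just (right (S zero))) c (S ∘ suc) G → Greedy c d S (true ∷ G)
    skip   : ∀ {m G} {S : Fin (suc m) → Interval} → ¬ Free c (S zero) → ¬ Free d (S zero) →
             Greedy c d (S ∘ suc) G → Greedy c d S (false ∷ G)

  Greedy⇒Feasible : ∀ {c d m} {S : Fin m → Interval} {G} → Greedy c d S G → Feasible c d S G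
  Greedy⇒Feasible []               = []
  Greedy⇒Feasible (first free g)   = first free (Greedy⇒Feasible g)
  Greedy⇒Feasible (second _ free g) = second free (Greedy⇒Feasible g)
  Greedy⇒Feasible (skip _ _ g)     = skip (Greedy⇒Feasible g)

  -- Optimality of the greedy selection

  sorted-tail : ∀ {m} {S : Fin (suc m) → Interval} →
                SortedByRightEndpoint S → SortedByRightEndpoint (S ∘ suc)
  sorted-tail sorted i j i≤j = sorted (suc i) (suc j) (s≤s i≤j)

  -- The number is the lead of greedy, with classes `c`, `d`, over a competitor with classes `x`,
  -- `y`. With lead 1 it is `c` that may be emptied: `d` then answers `x`, and the emptied class
  -- answers any `y`. With lead 2 or more both may be emptied, so nothing is demanded.
  Ahead : ℕ → (c d x y : End) → Set (a Level.⊔ ℓ₂)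
  Ahead 0             c d x y = c ≼ x × d ≼ y
  Ahead 1             c d x y = d ≼ x
  Ahead (suc (suc _)) c d x y = ⊤

  -- Induction along the scan: each step either preserves `Ahead` with the lead adjusted by what the
  -- two sides accept, or is impossible. The conditions on `c` and `d` express that `c` was extended
  -- last and that all remaining right ends come no earlier.
  Greedy-optimal : ∀ {m} {S : Fin m → Interval} {c d x y G F} δ → SortedByRightEndpoint S →
    d ≼ c → (∀ i → c ≼ just (right (S i))) → Ahead δ c d x y →
    Greedy c d S G → Feasible x y S F → ∣ F ∣ ≤ δ + ∣ G ∣
  Greedy-optimal {zero} δ sorted d≼c c≼ ahead [] [] = z≤n
  Greedy-optimal {suc m} {S} {c} {d} {x} {y} δ sorted d≼c c≼ = go δ
    where
    r : End
    r = just (right (S zero))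

    c≼r : c ≼ r
    c≼r = c≼ zero

    d≼r : d ≼ r
    d≼r J = d≼c J ∘ c≼r J

    r≼ : ∀ i → r ≼ just (right (S (suc i)))
    r≼ i = ≤⇒≼ (sorted zero (suc i) z≤n)

    accepted : ∀ {d′ x′ y′ G F} δ → d′ ≼ r → Ahead δ r d′ x′ y′ →
               Greedy r d′ (S ∘ suc) G → Feasible x′ y′ (S ∘ suc) F → ∣ F ∣ ≤ δ + ∣ G ∣
    accepted δ d′≼r = Greedy-optimal δ (sorted-tail {S = S} sorted) d′≼r r≼

    rejected : ∀ {x′ y′ G F} δ → Ahead δ c d x′ y′ →
               Greedy c d (S ∘ suc) G → Feasible x′ y′ (S ∘ suc) F → ∣ F ∣ ≤ δ + ∣ G ∣
    rejected δ = Greedy-optimal δ (sorted-tail {S = S} sorted) d≼c (c≼ ∘ suc)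

    both : ∀ {d′ x′ y′ G F} δ → d′ ≼ r → Ahead δ r d′ x′ y′ →
           Greedy r d′ (S ∘ suc) G → Feasible x′ y′ (S ∘ suc) F → suc ∣ F ∣ ≤ δ + suc ∣ G ∣
    both {G = G} δ d′≼r ahead g f =
      ≤-trans (s≤s (accepted δ d′≼r ahead g f)) (≤-reflexive (sym (+-suc δ ∣ G ∣)))

    onlyGreedy : ∀ {d′ x′ y′ G F} δ → d′ ≼ r → Ahead (suc δ) r d′ x′ y′ →
                 Greedy r d′ (S ∘ suc) G → Feasible x′ y′ (S ∘ suc) F → ∣ F ∣ ≤ δ + suc ∣ G ∣
    onlyGreedy {G = G} δ d′≼r ahead g f =
      ≤-trans (accepted (suc δ) d′≼r ahead g f) (≤-reflexive (sym (+-suc δ ∣ G ∣)))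

    go : ∀ {G F} δ → Ahead δ c d x y → Greedy c d S G → Feasible x y S F → ∣ F ∣ ≤ δ + ∣ G ∣
    go 0             (_ , d≼y) (first _ g) (first _ f) = both 0 d≼r ((λ _ → id) , d≼y) g f
    go 1             _         (first _ g) (first _ f) = both 1 d≼r d≼r g f
    go (suc (suc δ)) _         (first _ g) (first _ f) = both (suc (suc δ)) d≼r tt g f
    -- The competitor's `x` becomes its older class, and greedy keeps `d`, which precedes `c` and
    -- hence `x`.
    go 0             (c≼x , _) (first _ g) (second _ f) =
      both 0 d≼r ((λ _ → id) , λ J → d≼c J ∘ c≼x J) g f
    go 1             _         (first _ g) (second _ f) = both 1 d≼r d≼r g f
    go (suc (suc δ)) _         (first _ g) (second _ f) = both (suc (suc δ)) d≼r tt g f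
    -- The lead grows to 1, where only the older greedy class has to precede `x`.
    go 0             (c≼x , _) (first _ g) (skip f) = onlyGreedy 0 d≼r (λ J → d≼c J ∘ c≼x J) g f
    go (suc δ)       _         (first _ g) (skip f) = onlyGreedy (suc δ) d≼r tt g f
    go 0             (c≼x , _) (second c≢ _ g) (first x∥ f) = contradiction (c≼x _ x∥) c≢
    go 1             _         (second _ _ g) (first _ f) = both 1 c≼r c≼r g f
    go (suc (suc δ)) _         (second _ _ g) (first _ f) = both (suc (suc δ)) c≼r tt g f
    go 0             (c≼x , _) (second _ _ g) (second _ f) = both 0 c≼r ((λ _ → id) , c≼x) g f
    go 1             _         (second _ _ g) (second _ f) = both 1 c≼r c≼r g f
    go (suc (suc δ)) _         (second _ _ g) (second _ f) = both (suc (suc δ)) c≼r tt g f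
    go 0             (c≼x , _) (second _ _ g) (skip f) = onlyGreedy 0 c≼r c≼x g f
    go (suc δ)       _         (second _ _ g) (skip f) = onlyGreedy (suc δ) c≼r tt g f
    go 0             (c≼x , _) (skip c≢ _ g) (first x∥ f) = contradiction (c≼x _ x∥) c≢
    go 1             d≼x       (skip _ d≢ g) (first x∥ f) = contradiction (d≼x _ x∥) d≢
    go 2             _         (skip _ _ g) (first _ f) = s≤s (rejected 1 d≼r g f)
    go (suc (suc (suc δ))) _   (skip _ _ g) (first _ f) = s≤s (rejected (suc (suc δ)) tt g f)
    go 0             (_ , d≼y) (skip _ d≢ g) (second y∥ f) = contradiction (d≼y _ y∥) d≢
    go 1             d≼x       (skip _ _ g) (second _ f) = s≤s (rejected 0 (c≼r , d≼x) g f)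
    go 2             _         (skip _ _ g) (second _ f) = s≤s (rejected 1 d≼r g f)
    go (suc (suc (suc δ))) _   (skip _ _ g) (second _ f) = s≤s (rejected (suc (suc δ)) tt g f)
    go δ             ahead     (skip _ _ g) (skip f) = rejected δ ahead g f

  -- Colourings

  -- For intervals sorted by right endpoint this is disjointness within each colour: if the later
  -- one starts by `right (S i)`, that point lies in both.
  Separated : ∀ {m} (S : Fin m → Interval) (F : Subset m) → (∃ (_∈ F) → Bool) → Set ℓ₂
  Separated S F side = ∀ {i j} (p : i ∈ F) (q : j ∈ F) → i Fin.< j →
    side (i , p) ≡ side (j , q) → Free (just (right (S i))) (S j)

  ClassAfter : ∀ {m} (S : Fin m → Interval) (F : Subset m) → (∃ (_∈ F) → Bool) → Bool → End → Set ℓ₂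
  ClassAfter S F side s c = ∀ {i} (p : i ∈ F) → side (i , p) ≡ s → Free c (S i)

  extend : ∀ {m} {F : Subset m} {b} → Bool → (∃ (_∈ F) → Bool) → ∃ (_∈ (b ∷ F)) → Bool
  extend s side (zero  , here)    = s
  extend s side (suc i , there p) = side (i , p)

  -- The colour records the class an interval is appended to. The `ClassAfter` claims strengthen the
  -- induction: they separate the head from later intervals of its colour.
  Feasible⇒coloured : ∀ {m} {S : Fin m → Interval} {F c d} s t → s ≢ t → Feasible c d S F →
    ∃[ side ] Separated S F side × ClassAfter S F side s c × ClassAfter S F side t d
  Feasible⇒coloured s t s≢t [] = (λ ()) , (λ ()) , (λ ()) , (λ ())
  Feasible⇒coloured {S = S} {F = true ∷ F} {c} {d} s t s≢t (first free f)
    with side , sep , after-s , after-t ← Feasible⇒coloured s t s≢t f =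
      extend s side , sep′ , after-s′ , after-t′
    where
    sep′ : Separated S (true ∷ F) (extend s side)
    sep′ here      here      ()
    sep′ here      (there q) _         eq = after-s q (sym eq)
    sep′ (there p) (there q) (s≤s i<j) eq = sep p q i<j eq

    after-s′ : ClassAfter S (true ∷ F) (extend s side) s c
    after-s′ here      _  = free
    after-s′ (there p) eq = Free⇒≼right c (S zero) free _ (after-s p eq)

    after-t′ : ClassAfter S (true ∷ F) (extend s side) t d
    after-t′ here      eq = contradiction eq s≢t
    after-t′ (there p) eq = after-t p eq
  Feasible⇒coloured {S = S} {F = true ∷ F} {c} {d} s t s≢t (second free f)
    -- Extending the second class makes it the first, so the two colours exchange roles.
    with side , sep , after-t , after-s ← Feasible⇒coloured t s (≢-sym s≢t) f =
      extend t side , sep′ , after-s′ , after-t′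
    where
    sep′ : Separated S (true ∷ F) (extend t side)
    sep′ here      here      ()
    sep′ here      (there q) _         eq = after-t q (sym eq)
    sep′ (there p) (there q) (s≤s i<j) eq = sep p q i<j eq

    after-s′ : ClassAfter S (true ∷ F) (extend t side) s c
    after-s′ here      eq = contradiction (sym eq) s≢t
    after-s′ (there p) eq = after-s p eq

    after-t′ : ClassAfter S (true ∷ F) (extend t side) t d
    after-t′ here      _  = free
    after-t′ (there p) eq = Free⇒≼right d (S zero) free _ (after-t p eq)
  Feasible⇒coloured {S = S} {F = false ∷ F} {c} {d} s t s≢t (skip f)
    with side , sep , after-s , after-t ← Feasible⇒coloured s t s≢t f =
      extend s side ,
      (λ { (there p) (there q) (s≤s i<j) eq → sep p q i<j eq }) ,
      (λ { (there p) eq → after-s p eq }) ,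
      (λ { (there p) eq → after-t p eq })

  -- The colour of each chosen interval selects the constructor; `s` is always the colour of the
  -- class extended last, and separation from the head supplies `ClassAfter` for its new end.
  coloured⇒Feasible : ∀ {m} (S : Fin m → Interval) F {c d} s t → s ≢ t → (side : ∃ (_∈ F) → Bool) →
    Separated S F side → ClassAfter S F side s c → ClassAfter S F side t d → Feasible c d S F
  coloured⇒Feasible S [] s t s≢t side sep after-s after-t = []
  coloured⇒Feasible S (false ∷ F) s t s≢t side sep after-s after-t =
    skip (coloured⇒Feasible (S ∘ suc) F s t s≢t (λ (i , p) → side (suc i , there p))
      (λ p q i<j → sep (there p) (there q) (s≤s i<j))
      (after-s ∘ there) (after-t ∘ there))
  coloured⇒Feasible S (true ∷ F) s t s≢t side sep after-s after-t
    with side (zero , here) Bool.≟ s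
  ... | yes ≡s = first (after-s here ≡s)
    (coloured⇒Feasible (S ∘ suc) F s t s≢t (λ (i , p) → side (suc i , there p))
      (λ p q i<j → sep (there p) (there q) (s≤s i<j))
      (λ p eq → sep here (there p) (s≤s z≤n) (trans ≡s (sym eq)))
      (after-t ∘ there))
  ... | no ≢s = second (after-t here ≡t)
    (coloured⇒Feasible (S ∘ suc) F t s (≢-sym s≢t) (λ (i , p) → side (suc i , there p))
      (λ p q i<j → sep (there p) (there q) (s≤s i<j))
      (λ p eq → sep here (there p) (s≤s z≤n) (trans ≡t (sym eq)))
      (after-s ∘ there))
    where
    ≡t : side (zero , here) ≡ t
    ≡t = ≢-pair-exhaustive s≢t ≢s

  Feasible⇒InducesBipartite : ∀ {n} {S : Fin n → Interval} {F} → Feasible nothing nothing S F →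
                              InducesBipartite S F
  Feasible⇒InducesBipartite {S = S} {F} f
    with side , sep , _ ← Feasible⇒coloured true false (λ ()) f = side , proper
    where
    meet : ∀ {i j x} → x ∈ᴵ S i → x ∈ᴵ S j → left (S j) ≤ᴿ right (S i)
    meet (_ , x≤rᵢ) (lⱼ≤x , _) = ≤ᴿ-trans lⱼ≤x x≤rᵢ

    proper : ∀ u w → u ≢ w × Intersect (S (proj₁ u)) (S (proj₁ w)) → side u ≢ side w
    proper (i , p) (j , q) (u≢w , x , x∈i , x∈j) eq with Fin.<-cmp i j
    ... | tri< i<j _ _  = sep p q i<j eq (meet x∈i x∈j)
    ... | tri> _ _ j<i  = sep q p j<i (sym eq) (meet x∈j x∈i)
    -- Vertices carry membership proofs, and these are unique, so equal indices give equal vertices.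
    ... | tri≈ _ refl _ = u≢w (cong (i ,_) ([]=-irrelevant p q))

  InducesBipartite⇒Feasible : ∀ {n} (S : Fin n → Interval) F → SortedByRightEndpoint S →
                              InducesBipartite S F → Feasible nothing nothing S F
  InducesBipartite⇒Feasible S F sorted (side , proper) =
    coloured⇒Feasible S F true false (λ ()) side sep (λ _ _ → tt) (λ _ _ → tt)
    where
    sep : Separated S F side
    sep {i} {j} p q i<j eq lⱼ≤rᵢ = proper (i , p) (j , q)
      ( (λ u≡w → Fin.<-irrefl (cong proj₁ u≡w) i<j)
      -- By sortedness the earlier right endpoint is a common point, so the two vertices would be
      -- adjacent with equal colours.
      , right (S i) , (left≤right (S i) , ≤ᴿ-refl) , (lⱼ≤rᵢ , sorted i j (<⇒≤ i<j)))
      eq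

  Greedy⇒IsMaximum : ∀ {n} {S : Fin n → Interval} {G} → SortedByRightEndpoint S →
                     Greedy nothing nothing S G → IsMaximumBipartiteSubgraph S G
  Greedy⇒IsMaximum {S = S} sorted g =
    Feasible⇒InducesBipartite (Greedy⇒Feasible g) , λ F bipartite →
      Greedy-optimal 0 sorted (λ _ → id) (λ _ _ _ → tt) ((λ _ → id) , (λ _ → id)) g
        (InducesBipartite⇒Feasible S F sorted bipartite)

  -- Execution

  record Ensures {q} (P : Program) (T : ℕ) (Q : State → Set q) (s : State) : Set (a Level.⊔ q) where
    constructor ensures
    field
      {time}  : ℕ
      {final} : State
      run     : P ⊢ s ⇓[ time ] final
      within  : time ≤ T
      holds   : Q final

  module _ {q} {P : Program} {Q : State → Set q} where

    ensures-stop : ∀ {T s} → fetch P (State.pc s) ≡ nothing → Q s → Ensures P T Q s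
    ensures-stop end Qs = ensures (stop end) z≤n Qs

    ensures-step : ∀ {T s ins} → fetch P (State.pc s) ≡ just ins →
                   Ensures P T Q (execute ins s) → Ensures P (suc T) Q s
    ensures-step eq (ensures run t≤T Qs′) = ensures (step eq run) (s≤s t≤T) Qs′

    ensures-weaken : ∀ {T T′ s} → T ≤ T′ → Ensures P T Q s → Ensures P T′ Q s
    ensures-weaken T≤T′ (ensures run t≤T Qs′) = ensures run (≤-trans t≤T T≤T′) Qs′

    module _ {T p : ℕ} {I M : ℕ → ℕ} {R X : ℕ → ℝ} {i j r : ℕ} where

      private
        -- Abstracting the outcome of the test lets the decided value be substituted into the
        -- program counter.
        target : Bool → State
        target b = state (if b then r else suc p) I M R X

      ensures-if≤-true : fetch P p ≡ just (if≤ i j r) → I i ≤ I j →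
        Ensures P T Q (state r I M R X) → Ensures P (suc T) Q (state p I M R X)
      ensures-if≤-true eq le e = ensures-step eq
        (subst (Ensures P T Q ∘ target) (sym (dec-true (I i ≤? I j) le)) e)

      ensures-if≤-false : fetch P p ≡ just (if≤ i j r) → ¬ I i ≤ I j →
        Ensures P T Q (state (suc p) I M R X) → Ensures P (suc T) Q (state p I M R X)
      ensures-if≤-false eq ≰ e = ensures-step eq
        (subst (Ensures P T Q ∘ target) (sym (dec-false (I i ≤? I j) ≰)) e)

      ensures-if≤ᴿ-true : fetch P p ≡ just (if≤ᴿ i j r) → R i ≤ᴿ R j →
        Ensures P T Q (state r I M R X) → Ensures P (suc T) Q (state p I M R X)
      ensures-if≤ᴿ-true eq le e = ensures-step eq
        (subst (Ensures P T Q ∘ target) (sym (dec-true (R i ≤ᴿ? R j) le)) e)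

      ensures-if≤ᴿ-false : fetch P p ≡ just (if≤ᴿ i j r) → ¬ R i ≤ᴿ R j →
        Ensures P T Q (state (suc p) I M R X) → Ensures P (suc T) Q (state p I M R X)
      ensures-if≤ᴿ-false eq ≰ e = ensures-step eq
        (subst (Ensures P T Q ∘ target) (sym (dec-false (R i ≤ᴿ? R j) ≰)) e)

  ensures-map : ∀ {q q′ P T s} {Q : State → Set q} {Q′ : State → Set q′} →
                (∀ {s} → Q s → Q′ s) → Ensures P T Q s → Ensures P T Q′ s
  ensures-map f (ensures run t≤T Qs′) = ensures run t≤T (f Qs′)

  -- The flag stands in for an end at minus infinity: while it is 0 the real register is
  -- unconstrained, so its arbitrary initial content is harmless.
  Holds : End → ℕ → ℝ → Set a
  Holds nothing  flag x = Level.Lift a (flag ≡ 0)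
  Holds (just e) flag x = ¬ flag ≤ 0 × x ≡ e

  -- The two instructions decide `Free c J`: an empty class jumps over the real comparison, one step
  -- cheaper, and otherwise the comparison falls through exactly when `J` is free.
  ensures-test : ∀ {q P T p I M R X c f e r} {Q : State → Set q} (J : Interval) →
    fetch P p ≡ just (if≤ f 6 (2 + p)) → fetch P (suc p) ≡ just (if≤ᴿ 2 e r) →
    Holds c (I f) (R e) → I 6 ≡ 0 → R 2 ≡ left J →
    (Free c J → Ensures P T Q (state (2 + p) I M R X)) →
    (¬ Free c J → Ensures P T Q (state r I M R X)) →
    Ensures P (2 + T) Q (state p I M R X)
  ensures-test {c = nothing} J eq₁ eq₂ (Level.lift flag≡0) zero≡0 R2≡l free busy =
    ensures-weaken (n≤1+n _) (ensures-if≤-true eq₁ (≤-trans (≤-reflexive flag≡0) z≤n) (free tt))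
  ensures-test {R = R} {c = just x} {e = e} J eq₁ eq₂ (flag≰0 , Re≡x) zero≡0 R2≡l free busy =
    ensures-if≤-false eq₁ (flag≰0 ∘ λ le → ≤-trans le (≤-reflexive zero≡0)) test
    where
    l≤x≡ : (R 2 ≤ᴿ R e) ≡ (left J ≤ᴿ x)
    l≤x≡ = cong₂ _≤ᴿ_ R2≡l Re≡x

    test : _
    test with R 2 ≤ᴿ? R e
    ... | yes le = ensures-if≤ᴿ-true eq₂ le (busy (contradiction (subst id l≤x≡ le)))
    ... | no ≰  = ensures-if≤ᴿ-false eq₂ ≰ (free (≰ ∘ subst id (sym l≤x≡)))

  -- The main loop

  record LoopInvariant {m} (S : Fin m → Interval) (i : ℕ) (c d : End)
                       (I : ℕ → ℕ) (R X : ℕ → ℝ) : Set a where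
    field
      size    : I 0 ≡ i + m
      index   : I 1 ≡ i
      address : I 2 ≡ 2 * i
      one     : I 5 ≡ 1
      null    : I 6 ≡ 0
      end₁    : Holds c (I 3) (R 0)
      end₂    : Holds d (I 4) (R 1)
      lefts   : ∀ j → X (2 * (i + toℕ j)) ≡ left (S j)
      rights  : ∀ j → X (suc (2 * (i + toℕ j))) ≡ right (S j)

  record Written {m} (G : Subset m) (i : ℕ) (M : ℕ → ℕ) (s : State) : Set where
    constructor written
    field
      output : ∀ j → State.IMem s (i + toℕ j) ≡ (if lookup G j then 1 else 0)
      frame  : ∀ k → k < i → State.IMem s k ≡ M k

  -- The frame condition of the remaining iterations protects cell `i`, so the bit written there
  -- survives to the end.
  Written-∷ : ∀ {m} {G : Subset m} {i M M′ s} b → M′ i ≡ (if b then 1 else 0) →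
              (∀ {k} → k ≢ i → M′ k ≡ M k) → Written G (suc i) M′ s → Written (b ∷ G) i M s
  Written-∷ {G = G} {i} {s = s} b bit same (written out frame) =
    written out′ (λ k k<i → trans (frame k (m<n⇒m<1+n k<i)) (same (<⇒≢ k<i)))
    where
    out′ : ∀ j → State.IMem s (i + toℕ j) ≡ (if lookup (b ∷ G) j then 1 else 0)
    out′ zero    = trans (cong (State.IMem s) (+-identityʳ i)) (trans (frame i (n<1+n i)) bit)
    out′ (suc j) = trans (cong (State.IMem s) (+-suc i (toℕ j))) (out j)

  module _ {m} {S : Fin (suc m) → Interval} {i c d I R X} (inv : LoopInvariant S i c d I R X) where
    open LoopInvariant inv

    left-loaded : X (I 2) ≡ left (S zero)
    left-loaded = trans (cong X (trans address (cong (2 *_) (sym (+-identityʳ i))))) (lefts zero)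

    right-loaded : X (I 2 + I 5) ≡ right (S zero)
    right-loaded = trans (cong X eq) (rights zero)
      where
      eq : I 2 + I 5 ≡ suc (2 * (i + 0))
      eq = trans (cong₂ _+_ (trans address (cong (2 *_) (sym (+-identityʳ i)))) one) (+-comm _ 1)

    advance : ∀ {c′ d′ I′ R′} →
      I′ 0 ≡ I 0 → I′ 1 ≡ I 1 + I 5 → I′ 2 ≡ I 2 + I 5 + I 5 → I′ 5 ≡ I 5 → I′ 6 ≡ I 6 →
      Holds c′ (I′ 3) (R′ 0) → Holds d′ (I′ 4) (R′ 1) →
      LoopInvariant (S ∘ suc) (suc i) c′ d′ I′ R′ X
    advance e₀ e₁ e₂ e₅ e₆ end₁′ end₂′ = record
      { size    = trans e₀ (trans size (+-suc i m))
      ; index   = trans e₁ (trans (cong₂ _+_ index one) (+-comm i 1))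
      ; address = trans e₂ (trans (cong₂ _+_ (cong₂ _+_ address one) one) double-suc)
      ; one     = trans e₅ one
      ; null    = trans e₆ null
      ; end₁    = end₁′
      ; end₂    = end₂′
      ; lefts   = λ j → trans (cong (λ k → X (2 * k)) (sym (+-suc i (toℕ j)))) (lefts (suc j))
      ; rights  = λ j → trans (cong (λ k → X (suc (2 * k))) (sym (+-suc i (toℕ j)))) (rights (suc j))
      }
      where
      double-suc : 2 * i + 1 + 1 ≡ 2 * suc i
      double-suc = trans (+-assoc (2 * i) 1 1) (trans (+-comm (2 * i) 2) (sym (*-suc 2 i)))

  -- The longest iteration appends to the other class: 6 instructions of set-up, two tests of 2, and
  -- 8 to exchange, accept and advance, 18 in all. The extra 1 is the final exit test.
  loop : ∀ {m} {S : Fin m → Interval} {i c d I M R X} → LoopInvariant S i c d I R X →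
    Ensures greedyProgram (m * 18 + 1) (λ s → ∃[ G ] Greedy c d S G × Written G i M s)
      (state 6 I M R X)
  loop {zero} {i = i} inv =
    ensures-if≤-true refl
      (≤-reflexive (trans size (trans (+-identityʳ i) (sym index))))
      (ensures-stop refl ([] , [] , written (λ ()) (λ _ _ → refl)))
    where open LoopInvariant inv
  loop {suc m} {S} {i} {c} {d} {I} {M} {R} {X} inv =
    ensures-if≤-false refl unfinished
    (ensures-step refl
    (ensures-step refl
    (ensures-step refl
    (ensures-step refl
    (ensures-step refl
    (ensures-test {c = c} (S zero) refl refl end₁ null (left-loaded inv)
      (λ free →
        -- This branch takes 13 of the 18 steps allowed.
        ensures-weaken (m≤n+m _ 5)
        (ensures-step refl
        (ensures-step refl
        (ensures-step refl
        (ensures-step refl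
        (ensures-step refl
        (ensures-map
          (λ (G , g , w) → true ∷ G , first free g , Written-∷ true bit-true same-true w)
        (loop (advance inv refl refl refl refl refl ((λ ()) , right-loaded inv) end₂)))))))))
      (λ busy →
        ensures-test {c = d} (S zero) refl refl end₂ null (left-loaded inv)
          (λ free →
            ensures-step refl
            (ensures-step refl
            (ensures-step refl
            (ensures-step refl
            (ensures-step refl
            (ensures-step refl
            (ensures-step refl
            (ensures-step refl
            (ensures-map
              (λ (G , g , w) → true ∷ G , second busy free g , Written-∷ true bit-true same-true w)
            (loop (advance inv refl refl refl refl refl ((λ ()) , right-loaded inv)
              (nonempty c end₁ busy))))))))))))
          (λ busy′ →
            -- Rejection takes at most 12 of the 18 steps.
            ensures-weaken (m≤n+m _ 6)
            (ensures-step refl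
            (ensures-step refl
            (ensures-map
              (λ (G , g , w) → false ∷ G , skip busy busy′ g , Written-∷ false bit-false same-false w)
            (loop (advance inv refl refl refl refl refl end₁ end₂)))))))))))))
    where
    open LoopInvariant inv

    unfinished : ¬ I 0 ≤ I 1
    unfinished le = m+1+n≰m i (≤-trans (≤-reflexive (sym size)) (≤-trans le (≤-reflexive index)))

    -- The exchange sets the flag of the other class to 1 outright; this is sound because a class
    -- that blocks an interval is nonempty.
    nonempty : ∀ c → Holds c (I 3) (R 0) → ¬ Free c (S zero) → Holds c 1 (R 0)
    nonempty nothing  _       busy = contradiction tt busy
    nonempty (just _) (_ , e) _    = (λ ()) , e

    -- The bit 0 is stored before the tests and overwritten by 1 only on acceptance.
    M₀ M₁ : ℕ → ℕ
    M₀ = M [ I 1 ≔ I 6 ]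
    M₁ = M₀ [ I 1 ≔ I 5 ]

    bit-false : M₀ i ≡ 0
    bit-false = trans (≔-same M (sym index)) null

    same-false : ∀ {k} → k ≢ i → M₀ k ≡ M k
    same-false k≢i = ≔-other M (λ k≡ → k≢i (trans k≡ index))

    bit-true : M₁ i ≡ 1
    bit-true = trans (≔-same M₀ (sym index)) one

    same-true : ∀ {k} → k ≢ i → M₁ k ≡ M k
    same-true k≢i = trans (≔-other M₀ (λ k≡ → k≢i (trans k≡ index))) (same-false k≢i)

  -- Correctness and linear running time

  greedyProgram-solves : ∀ {n} (S : Fin n → Interval) → SortedByRightEndpoint S →
                         SolvesMBSWithin greedyProgram (6 + (n * 18 + 1)) S
  greedyProgram-solves S sorted (state _ I M R X)
      record { start = refl ; size = size ; lefts = lefts ; rights = rights } =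
    let ensures run t≤T (G , g , written out _) = halts
    in  _ , _ , G , run , t≤T , out , Greedy⇒IsMaximum sorted g
    where
    halts : Ensures greedyProgram _ (λ s → ∃[ G ] Greedy nothing nothing S G × Written G 0 M s)
              (state 0 I M R X)
    halts =
      ensures-step refl
      (ensures-step refl
      (ensures-step refl
      (ensures-step refl
      (ensures-step refl
      (ensures-step refl
      (loop record
        { size = size ; index = refl ; address = refl ; one = refl ; null = refl
        ; end₁ = Level.lift refl ; end₂ = Level.lift refl ; lefts = lefts ; rights = rights }))))))

theorem1 : (a ℓ₁ ℓ₂ : Level) →
    Σ[ P ∈ Program ] Σ[ T ∈ (ℕ → ℕ) ] (T ∈O (λ n → n)) ×
    ((Line : DecTotalOrder a ℓ₁ ℓ₂) → let open OverLine Line in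
    (n : ℕ) (S : Fin n → Interval) →
    DistinctEndpoints S → SortedByRightEndpoint S →
    SolvesMBSWithin P (T n) S)
theorem1 a ℓ₁ ℓ₂ =
  -- The 6 counts the initialising instructions, and 25 = 6 + 18 + 1 is the bound at `n` = 1; the
  -- threshold 1 excludes `n` = 0, where the constant cost remains.
  greedyProgram , (λ n → 6 + (n * 18 + 1)) , (25 , 1 , linear) ,
  λ Line n S _ sorted → greedyProgram-solves Line S sorted
  where
  linear : ∀ n → 1 ≤ n → 6 + (n * 18 + 1) ≤ 25 * n
  linear (suc n) _ = begin
    24 + (n * 18 + 1)  ≡⟨ cong (24 +_) (+-comm (n * 18) 1) ⟩
    25 + n * 18        ≤⟨ +-monoʳ-≤ 25 (*-monoʳ-≤ n (m≤m+n 18 7)) ⟩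
    25 + n * 25        ≡⟨ *-comm (suc n) 25 ⟩
    25 * suc n         ∎
    where open ≤-Reasoning
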